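{- Let $\lambda, n \in \mathbb{N}$. Then $$\widetilde{\chi}(\lambda K_n) = \begin{cases} 3 & \text{if } \lambda \text{ is odd and } n \equiv 3 \pmod 4,\\ 2 & \text{otherwise.}\end{cases}$$
   Context: $\mathbb{N}$ denotes the positive integers. A multigraph $G=(V,E)$ is finite and without loops; parallel edges are allowed. For $x\in V$, $E(x)$ denotes the set of edges of $G$ incident to $x$ (parallel edges counted separately). $\lambda K_n$ is the complete multigraph on $n$ vertices in which every pair of distinct vertices is joined by exactly $\lambda$ parallel edges. For an integer $m\ge 2$, an $m$-homogeneous edge-coloring of $G$ is a map $c\colon E\to S$, where $S$ is a set of colors with $|S|=m$ ($c$ is not required to be surjective or proper), such that for every $x\in V$, writing $|E(x)|=m q_x+r_x$ with $0\le r_x<m$, exactly $r_x$ of the colors in $S$ are each assigned to exactly $q_x+1$ edges of $E(x)$, and each of the other $m-r_x$ colors is assigned to exactly $q_x$ edges of $E(x)$. (In particular, if $|E(x)|<m$, the edges of $E(x)$ have pairwise different colors.) The homogeneous chromatic index $\widetilde{\chi}(G)$ is the minimum integer $m\ge 2$ such that $G$ admits an $m$-homogeneous edge-coloring. -}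

module Defs where

open import Data.Nat using (ℕ; suc; _+_; _*_; _≤_; _<_)
open import Data.Fin using (Fin; _≟_)
open import Data.Fin.Subset using (Subset; _∈_; _∉_; ∣_∣)
open import Data.List using (List; length; filter; allFin)
open import Data.Product using (_×_; _,_; proj₁; proj₂; ∃-syntax)
open import Data.Product.Properties using (≡-dec)
open import Data.Sum using (_⊎_)
open import Relation.Nullary using (Dec)
open import Relation.Nullary.Decidable using (_⊎-dec_)
open import Relation.Binary.PropositionalEquality using (_≡_; _≢_)

-- Vertices and edges are numbered. Several edges may have the same ends. Each
-- edge lists its two ends in some order; nothing below depends on that order.
record Multigraph : Set where
  field
    order    : ℕ
    size     : ℕ
    ends     : Fin size → Fin order × Fin order
    loopless : ∀ e → proj₁ (ends e) ≢ proj₂ (ends e)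

  Vertex : Set
  Vertex = Fin order

  Edge : Set
  Edge = Fin size

  Incident : Vertex → Edge → Set
  Incident x e = proj₁ (ends e) ≡ x ⊎ proj₂ (ends e) ≡ x

  incident? : ∀ x e → Dec (Incident x e)
  incident? x e = (proj₁ (ends e) ≟ x) ⊎-dec (proj₂ (ends e) ≟ x)

  Joins : Vertex → Vertex → Edge → Set
  Joins x y e = ends e ≡ (x , y) ⊎ ends e ≡ (y , x)

  joins? : ∀ x y e → Dec (Joins x y e)
  joins? x y e = ≡-dec _≟_ _≟_ (ends e) (x , y) ⊎-dec ≡-dec _≟_ _≟_ (ends e) (y , x)

  -- E(x)
  edgesAt : Vertex → List Edge
  edgesAt x = filter (incident? x) (allFin size)

  edgesBetween : Vertex → Vertex → List Edge
  edgesBetween x y = filter (joins? x y) (allFin size)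

open Multigraph

-- G is (a copy of) λKₙ, with l for λ.
record IsCompleteMultigraph (l n : ℕ) (G : Multigraph) : Set where
  field
    order≡n : order G ≡ n
    joined  : ∀ (x y : Vertex G) → x ≢ y → length (edgesBetween G x y) ≡ l

Coloring : Multigraph → ℕ → Set
Coloring G m = Edge G → Fin m

colorCount : (G : Multigraph) {m : ℕ} → Coloring G m → Vertex G → Fin m → ℕ
colorCount G c x s = length (filter (λ e → c e ≟ s) (edgesAt G x))

-- T is the set of the r colors that occur q + 1 times at x.
HomogeneousAt : (G : Multigraph) {m : ℕ} → Coloring G m → Vertex G → Set
HomogeneousAt G {m} c x =
  ∃[ q ] ∃[ r ] (length (edgesAt G x) ≡ m * q + r) × (r < m) ×
    (∃[ T ] (∣ T ∣ ≡ r)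
          × (∀ (s : Fin m) → s ∈ T → colorCount G c x s ≡ suc q)
          × (∀ (s : Fin m) → s ∉ T → colorCount G c x s ≡ q))

IsHomogeneous : (G : Multigraph) {m : ℕ} → Coloring G m → Set
IsHomogeneous G c = ∀ x → HomogeneousAt G c x

HasHomogeneousColoring : Multigraph → ℕ → Set
HasHomogeneousColoring G m = ∃[ c ] IsHomogeneous G {m} c

-- χ̃(G) = m, as a relation.
record HomogeneousChromaticIndex (G : Multigraph) (m : ℕ) : Set where
  field
    2≤m      : 2 ≤ m
    coloring : HasHomogeneousColoring G m
    minimal  : ∀ k → 2 ≤ k → HasHomogeneousColoring G k → m ≤ k

{-# OPTIONS --safe #-}
module Submission where

-- Take a symmetric p × p table of m colors in which every row and the diagonal
-- contain each color w times, and write n = r + k p. Put r vertices aside and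
-- give each of the p classes k of the others. Two classified vertices get the
-- table entry of their classes, and a classified vertex of class a gets the
-- entry (a, a) with every vertex set aside. Let d be the diagonal color of x
-- (arbitrary if x was set aside). If every vertex, x included (paired with itself
-- in color d), is counted, then color s occurs k w + r [s = d] times at x.
-- The parallel edges of a pair are colored by cyclic shifts of the color of that
-- pair, so with M s the number of shifts of d, among the first l, that equal s,
-- the number N s of edges of color s at x satisfies N s + M s = k w l + r M s.
-- The values of M differ by at most 1, hence so do those of N if r ≤ 2; and
-- N is constant for every r if M is, as happens for m = 2 and l even. The tables
-- with (m, p) = (2, 4) and (3, 3) give all the colorings needed.
-- For l odd and n ≡ 3 (mod 4), each class of a 2-homogeneous coloring would be a
-- regular graph of odd degree l (n − 1) / 2 on an odd number of vertices.

open import Data.Bool using (true; false; if_then_else_)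
open import Data.Empty using (⊥-elim)
open import Data.Fin using (Fin; zero; suc; toℕ; splitAt; _≟_)
open import Data.Fin.Patterns using (0F; 1F; 2F; 3F)
open import Data.Fin.Properties using (suc-injective; all?)
open import Data.Fin.Subset using (_∈_; _∉_; ∣_∣; _-_)
open import Data.Fin.Subset.Properties using (∣p∣≤n; ∣p∣≡n⇒p≡⊤; ∈⊤; x∈p⇒∣p-x∣<∣p∣)
open import Data.List using (length; filter; tabulate)
open import Data.Maybe using (Maybe; just; nothing)
open import Data.Nat as ℕ using (ℕ; zero; suc; _+_; _*_; _≤_; _<_; z≤n; s≤s; _%_; _/_; _≤?_)
open import Data.Nat.DivMod using (m≡m%n+[m/n]*n; m%n<n)
open import Data.Nat.Properties hiding (_≟_; suc-injective)
open import Data.Nat.Tactic.RingSolver using (solve-∀)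
open import Data.Product using (_×_; _,_; proj₁; proj₂; ∃-syntax)
open import Data.Product.Properties using (≡-dec)
open import Data.Sum using (inj₁; inj₂)
open import Data.Sum.Properties using ([,]-map)
open import Data.Vec as Vec using ()
open import Data.Vec.Functional using (_++_)
open import Data.Vec.Properties using ([]=⇒lookup; lookup⇒[]=; lookup∘tabulate)
open import Function using (_∘_; id; case_of_)
open import Relation.Binary.PropositionalEquality
open import Relation.Nullary using (Dec; yes; no; does; ¬_; contradiction)
open import Relation.Nullary.Decidable using (_⊎-dec_; from-yes; dec-true; dec-false)
open import Relation.Unary using (Pred; Decidable)
open import Algebra.Properties.Semiring.Sum +-*-semiring
  using (sum; sum-syntax; sum-cong-≗; ∑-distrib-+; ∑-comm; *-distribˡ-sum; *-distribʳ-sum; sum-replicate-zero)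
open import Defs

open ≡-Reasoning

-- Sums and Iverson brackets

⟦_⟧ : ∀ {a} {A : Set a} → Dec A → ℕ
⟦ d ⟧ = if does d then 1 else 0

⟦⟧-yes : ∀ {a} {A : Set a} (d : Dec A) → A → ⟦ d ⟧ ≡ 1
⟦⟧-yes d a = cong (if_then 1 else 0) (dec-true d a)

⟦⟧-no : ∀ {a} {A : Set a} (d : Dec A) → ¬ A → ⟦ d ⟧ ≡ 0
⟦⟧-no d ¬a = cong (if_then 1 else 0) (dec-false d ¬a)

sum-const : ∀ n c → ∑[ i < n ] c ≡ n * c
sum-const zero    c = refl
sum-const (suc n) c = cong (c +_) (sum-const n c)

sum-≟ˡ : ∀ {n} (u : Fin n) → ∑[ y < n ] ⟦ u ≟ y ⟧ ≡ 1
sum-≟ˡ {suc n} zero    = cong suc (sum-replicate-zero n)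
sum-≟ˡ (suc u) = sum-≟ˡ u

sum-≟ʳ : ∀ {n} (u : Fin n) → ∑[ y < n ] ⟦ y ≟ u ⟧ ≡ 1
sum-≟ʳ {suc n} zero    = cong suc (sum-replicate-zero n)
sum-≟ʳ (suc u) = sum-≟ʳ u

-- Serves to count `x` as a neighbor of itself: `f` holds the true contributions of the vertices `y`
-- to a count at `x`, with nothing at `x` because there are no loops, and `g` adds a fictitious pair
-- (x, x).
sum-update : ∀ {n} (f g : Fin n → ℕ) (x : Fin n) → f x ≡ 0 →
             (∀ y → x ≢ y → f y ≡ g y) → sum f + g x ≡ sum g
sum-update f g zero fx≡0 f≗g rewrite fx≡0
  | sum-cong-≗ (λ y → f≗g (suc y) λ ()) = +-comm _ (g zero)
sum-update f g (suc x) fx≡0 f≗g rewrite f≗g zero (λ ())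
  = trans (+-assoc (g zero) _ _)
      (cong (g zero +_) (sum-update (f ∘ suc) (g ∘ suc) x fx≡0 (λ y x≢y → f≗g (suc y) (x≢y ∘ suc-injective))))

length-filter-tabulate : ∀ {a p} {A : Set a} {P : Pred A p} (P? : Decidable P) {n} (g : Fin n → A) →
                         length (filter P? (tabulate g)) ≡ ∑[ i < n ] ⟦ P? (g i) ⟧
length-filter-tabulate P? {zero}  g = refl
length-filter-tabulate P? {suc n} g with does (P? (g zero))
... | true  = cong suc (length-filter-tabulate P? (g ∘ suc))
... | false = length-filter-tabulate P? (g ∘ suc)

length-filter-filter-tabulate : ∀ {a p q} {A : Set a} {P : Pred A p} {Q : Pred A q}
                                (P? : Decidable P) (Q? : Decidable Q) {n} (g : Fin n → A) →
                                length (filter Q? (filter P? (tabulate g))) ≡ ∑[ i < n ] (⟦ P? (g i) ⟧ * ⟦ Q? (g i) ⟧)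
length-filter-filter-tabulate P? Q? {zero}  g = refl
length-filter-filter-tabulate P? Q? {suc n} g with does (P? (g zero))
... | false = length-filter-filter-tabulate P? Q? (g ∘ suc)
... | true with does (Q? (g zero))
...   | true  = cong suc (length-filter-filter-tabulate P? Q? (g ∘ suc))
...   | false = length-filter-filter-tabulate P? Q? (g ∘ suc)

⟦⊎⟧ : ∀ {a b} {A : Set a} {B : Set b} (a? : Dec A) (b? : Dec B) → ¬ (A × B) →
      ⟦ a? ⊎-dec b? ⟧ ≡ ⟦ a? ⟧ + ⟦ b? ⟧
⟦⊎⟧ (yes a) (yes b) ¬ab = ⊥-elim (¬ab (a , b))
⟦⊎⟧ (yes a) (no _)  _   = refl
⟦⊎⟧ (no _)  (yes _) _   = refl
⟦⊎⟧ (no _)  (no _)  _   = refl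

⟦⊎⟧-comm : ∀ {a b} {A : Set a} {B : Set b} (a? : Dec A) (b? : Dec B) →
           ⟦ a? ⊎-dec b? ⟧ ≡ ⟦ b? ⊎-dec a? ⟧
⟦⊎⟧-comm (yes _) (yes _) = refl
⟦⊎⟧-comm (yes _) (no _)  = refl
⟦⊎⟧-comm (no _)  (yes _) = refl
⟦⊎⟧-comm (no _)  (no _)  = refl

⟦≡-dec⟧ : ∀ {n} (u v x y : Fin n) → ⟦ ≡-dec _≟_ _≟_ (u , v) (x , y) ⟧ ≡ ⟦ u ≟ x ⟧ * ⟦ v ≟ y ⟧
⟦≡-dec⟧ u v x y with u ≟ x
... | no _ = refl
... | yes refl with v ≟ y
...   | yes _ = refl
...   | no _  = refl

-- Numbering the elements of a decidable subset of Fin n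

-- Only elements strictly before `e` are counted, so the elements of `P` get the ranks 0, 1, 2, ...
-- in order. This will number the parallel edges of a pair.
rank : ∀ {p n} {P : Pred (Fin n) p} → Decidable P → Fin n → ℕ
rank P? zero    = 0
rank P? (suc e) = ⟦ P? zero ⟧ + rank (P? ∘ suc) e

rank-cong : ∀ {p q n} {P : Pred (Fin n) p} {Q : Pred (Fin n) q} (P? : Decidable P) (Q? : Decidable Q) →
            (∀ e → ⟦ P? e ⟧ ≡ ⟦ Q? e ⟧) → ∀ e → rank P? e ≡ rank Q? e
rank-cong P? Q? P≗Q zero    = refl
rank-cong P? Q? P≗Q (suc e) = cong₂ _+_ (P≗Q zero) (rank-cong (P? ∘ suc) (Q? ∘ suc) (P≗Q ∘ suc) e)

-- On `P` the rank takes each value below the size of `P` exactly once. If `zero` lies in `P`, it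
-- takes rank 0 and moves all other ranks up by one, whence `φ ∘ suc`.
sum-rank : ∀ {p n} {P : Pred (Fin n) p} (P? : Decidable P) (φ : ℕ → ℕ) →
           ∑[ e < n ] (⟦ P? e ⟧ * φ (rank P? e)) ≡ ∑[ a < (∑[ e < n ] ⟦ P? e ⟧) ] φ (toℕ a)
sum-rank {n = zero}  P? φ = refl
sum-rank {n = suc n} P? φ with does (P? zero)
... | true  = cong₂ _+_ (+-identityʳ (φ 0)) (sum-rank (P? ∘ suc) (φ ∘ suc))
... | false = sum-rank (P? ∘ suc) φ

-- Nearly equal color counts

∃-argmin : ∀ {m} (f : Fin (suc m) → ℕ) → ∃[ s ] (∀ t → f s ≤ f t)
∃-argmin {zero}  f = zero , λ { zero → ≤-refl }
∃-argmin {suc m} f with ∃-argmin (f ∘ suc)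
... | s , min with ≤-total (f zero) (f (suc s))
...   | inj₁ f0≤ = zero , λ { zero → ≤-refl ; (suc t) → ≤-trans f0≤ (min t) }
...   | inj₂ ≤f0 = suc s , λ { zero → ≤f0 ; (suc t) → min t }

∣tabulate-does∣ : ∀ {m p} {P : Pred (Fin m) p} (P? : Decidable P) →
                  ∣ Vec.tabulate (does ∘ P?) ∣ ≡ ∑[ s < m ] ⟦ P? s ⟧
∣tabulate-does∣ {zero}  P? = refl
∣tabulate-does∣ {suc m} P? with does (P? zero)
... | true  = cong suc (∣tabulate-does∣ (P? ∘ suc))
... | false = ∣tabulate-does∣ (P? ∘ suc)

∈-tabulate-does⁻ : ∀ {m p} {P : Pred (Fin m) p} (P? : Decidable P) s →
                   s ∈ Vec.tabulate (does ∘ P?) → P s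
∈-tabulate-does⁻ P? s s∈ with P? s | trans (sym (lookup∘tabulate (does ∘ P?) s)) ([]=⇒lookup s∈)
... | yes p | _ = p

∈-tabulate-does⁺ : ∀ {m p} {P : Pred (Fin m) p} (P? : Decidable P) s →
                   P s → s ∈ Vec.tabulate (does ∘ P?)
∈-tabulate-does⁺ P? s ps with P? s | lookup∘tabulate (does ∘ P?) s
... | yes _ | eq = lookup⇒[]= s _ eq
... | no ¬p | _  = contradiction ps ¬p

Balanced : ∀ {m} → (Fin m → ℕ) → Set
Balanced f = ∀ s t → f s ≤ suc (f t)

module _ (G : Multigraph) where
  open Multigraph G

  colorCount≡sum : ∀ {m} (c : Coloring G m) x s →
                   colorCount G c x s ≡ ∑[ e < size ] (⟦ incident? x e ⟧ * ⟦ c e ≟ s ⟧)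
  colorCount≡sum c x s = length-filter-filter-tabulate (incident? x) (λ e → c e ≟ s) id

  degree≡sum : ∀ x → length (edgesAt x) ≡ ∑[ e < size ] ⟦ incident? x e ⟧
  degree≡sum x = length-filter-tabulate (incident? x) id

  sum-colorCount : ∀ {m} (c : Coloring G m) x → ∑[ s < m ] colorCount G c x s ≡ length (edgesAt x)
  sum-colorCount {m} c x = begin
    ∑[ s < m ] colorCount G c x s
      ≡⟨ sum-cong-≗ (colorCount≡sum c x) ⟩
    ∑[ s < m ] ∑[ e < size ] (⟦ incident? x e ⟧ * ⟦ c e ≟ s ⟧)
      ≡⟨ ∑-comm (λ s e → ⟦ incident? x e ⟧ * ⟦ c e ≟ s ⟧) ⟩
    ∑[ e < size ] ∑[ s < m ] (⟦ incident? x e ⟧ * ⟦ c e ≟ s ⟧)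
      ≡⟨ sum-cong-≗ (λ e → *-distribˡ-sum ⟦ incident? x e ⟧ (λ s → ⟦ c e ≟ s ⟧)) ⟨
    ∑[ e < size ] (⟦ incident? x e ⟧ * ∑[ s < m ] ⟦ c e ≟ s ⟧)
      ≡⟨ sum-cong-≗ (λ e → trans (cong (⟦ incident? x e ⟧ *_) (sum-≟ˡ (c e))) (*-identityʳ _)) ⟩
    ∑[ e < size ] ⟦ incident? x e ⟧
      ≡⟨ degree≡sum x ⟨
    length (edgesAt x) ∎

  -- Take the least count as q and the colors that occur q + 1 times as T. A color attaining the
  -- minimum lies outside T, so T has fewer elements than there are colors; adding up the counts
  -- gives the degree.
  balanced⇒homogeneousAt : ∀ {m} (c : Coloring G (suc m)) x →
                           Balanced (colorCount G c x) → HomogeneousAt G c x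
  balanced⇒homogeneousAt {m} c x bal = q , ∣ T ∣ , deg , ∣T∣<m , T , refl ,
    (λ s → ∈-tabulate-does⁻ high? s) ,
    (λ s s∉T → ≤-antisym (low s s∉T) (q-min s))
    where
    f = colorCount G c x
    s₀ = proj₁ (∃-argmin f)
    q = f s₀
    q-min = proj₂ (∃-argmin f)
    high? : Decidable (λ s → f s ≡ suc q)
    high? s = f s ℕ.≟ suc q
    T = Vec.tabulate (does ∘ high?)
    low : ∀ s → s ∉ T → f s ≤ q
    low s s∉T = ≤-pred (≤∧≢⇒< (bal s s₀) (s∉T ∘ ∈-tabulate-does⁺ high? s))
    f≡ : ∀ s → f s ≡ q + ⟦ high? s ⟧
    f≡ s with f s ℕ.≟ suc q
    ... | yes fs≡ = trans fs≡ (trans (+-comm 1 q) (cong (q +_) (sym (⟦⟧-yes (high? s) fs≡))))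
    ... | no  fs≢ = trans (≤-antisym (≤-pred (≤∧≢⇒< (bal s s₀) fs≢)) (q-min s))
                      (trans (sym (+-identityʳ q)) (cong (q +_) (sym (⟦⟧-no (high? s) fs≢))))
    ∣T∣<m : ∣ T ∣ < suc m
    ∣T∣<m = ≤∧≢⇒< (∣p∣≤n T) λ full →
      1+n≢n (sym (∈-tabulate-does⁻ high? s₀ (subst (s₀ ∈_) (sym (∣p∣≡n⇒p≡⊤ full)) ∈⊤)))
    deg : length (edgesAt x) ≡ suc m * q + ∣ T ∣
    deg = begin
      length (edgesAt x)                                    ≡⟨ sum-colorCount c x ⟨
      sum f                                                 ≡⟨ sum-cong-≗ f≡ ⟩
      ∑[ s < suc m ] (q + ⟦ high? s ⟧)                      ≡⟨ ∑-distrib-+ (λ _ → q) (⟦_⟧ ∘ high?) ⟩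
      ∑[ s < suc m ] q + ∑[ s < suc m ] ⟦ high? s ⟧         ≡⟨ cong₂ _+_ (sum-const (suc m) q) (sym (∣tabulate-does∣ high?)) ⟩
      suc m * q + ∣ T ∣                                     ∎

  -- Double counting of incidences

  module _ (e : Edge) where
    private
      u = proj₁ (ends e)
      v = proj₂ (ends e)

    ⟦incident⟧ : ∀ x → ⟦ incident? x e ⟧ ≡ ⟦ u ≟ x ⟧ + ⟦ v ≟ x ⟧
    ⟦incident⟧ x = ⟦⊎⟧ (u ≟ x) (v ≟ x) λ (u≡x , v≡x) → loopless e (trans u≡x (sym v≡x))

    sum-incident : ∑[ x < order ] ⟦ incident? x e ⟧ ≡ 2
    sum-incident = begin
      ∑[ x < order ] ⟦ incident? x e ⟧                        ≡⟨ sum-cong-≗ ⟦incident⟧ ⟩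
      ∑[ x < order ] (⟦ u ≟ x ⟧ + ⟦ v ≟ x ⟧)                  ≡⟨ ∑-distrib-+ (λ x → ⟦ u ≟ x ⟧) (λ x → ⟦ v ≟ x ⟧) ⟩
      ∑[ x < order ] ⟦ u ≟ x ⟧ + ∑[ x < order ] ⟦ v ≟ x ⟧     ≡⟨ cong₂ _+_ (sum-≟ˡ u) (sum-≟ˡ v) ⟩
      2                                                       ∎

    joins-irrefl : ∀ x → ⟦ joins? x x e ⟧ ≡ 0
    joins-irrefl x = ⟦⟧-no (joins? x x e) λ where
      (inj₁ eq) → loopless e (trans (cong proj₁ eq) (sym (cong proj₂ eq)))
      (inj₂ eq) → loopless e (trans (cong proj₁ eq) (sym (cong proj₂ eq)))

    -- An edge at `x` has exactly one other end. Having no loops makes the two orientations in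
    -- `Joins` exclude each other, so their brackets add.
    sum-joins : ∀ x → ∑[ y < order ] ⟦ joins? x y e ⟧ ≡ ⟦ incident? x e ⟧
    sum-joins x = begin
      ∑[ y < order ] ⟦ joins? x y e ⟧
        ≡⟨ sum-cong-≗ (λ y → trans
             (⟦⊎⟧ (≡-dec _≟_ _≟_ (u , v) (x , y)) (≡-dec _≟_ _≟_ (u , v) (y , x))
                λ (p , q) → loopless e (trans (cong proj₁ p) (sym (cong proj₂ q))))
             (cong₂ _+_ (⟦≡-dec⟧ u v x y) (trans (⟦≡-dec⟧ u v y x) (*-comm ⟦ u ≟ y ⟧ _)))) ⟩
      ∑[ y < order ] (⟦ u ≟ x ⟧ * ⟦ v ≟ y ⟧ + ⟦ v ≟ x ⟧ * ⟦ u ≟ y ⟧)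
        ≡⟨ ∑-distrib-+ (λ y → ⟦ u ≟ x ⟧ * ⟦ v ≟ y ⟧) (λ y → ⟦ v ≟ x ⟧ * ⟦ u ≟ y ⟧) ⟩
      ∑[ y < order ] (⟦ u ≟ x ⟧ * ⟦ v ≟ y ⟧) + ∑[ y < order ] (⟦ v ≟ x ⟧ * ⟦ u ≟ y ⟧)
        ≡⟨ cong₂ _+_ (*-distribˡ-sum ⟦ u ≟ x ⟧ (λ y → ⟦ v ≟ y ⟧)) (*-distribˡ-sum ⟦ v ≟ x ⟧ (λ y → ⟦ u ≟ y ⟧)) ⟨
      ⟦ u ≟ x ⟧ * ∑[ y < order ] ⟦ v ≟ y ⟧ + ⟦ v ≟ x ⟧ * ∑[ y < order ] ⟦ u ≟ y ⟧
        ≡⟨ cong₂ (λ a b → ⟦ u ≟ x ⟧ * a + ⟦ v ≟ x ⟧ * b) (sum-≟ˡ v) (sum-≟ˡ u) ⟩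
      ⟦ u ≟ x ⟧ * 1 + ⟦ v ≟ x ⟧ * 1
        ≡⟨ cong₂ _+_ (*-identityʳ ⟦ u ≟ x ⟧) (*-identityʳ ⟦ v ≟ x ⟧) ⟩
      ⟦ u ≟ x ⟧ + ⟦ v ≟ x ⟧
        ≡⟨ ⟦incident⟧ x ⟨
      ⟦ incident? x e ⟧ ∎

  sum-incident-by-neighbor : ∀ x (ψ : Edge → ℕ) →
    ∑[ e < size ] (⟦ incident? x e ⟧ * ψ e) ≡ ∑[ y < order ] ∑[ e < size ] (⟦ joins? x y e ⟧ * ψ e)
  sum-incident-by-neighbor x ψ = begin
    ∑[ e < size ] (⟦ incident? x e ⟧ * ψ e)
      ≡⟨ sum-cong-≗ (λ e → cong (_* ψ e) (sum-joins e x)) ⟨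
    ∑[ e < size ] (∑[ y < order ] ⟦ joins? x y e ⟧ * ψ e)
      ≡⟨ sum-cong-≗ (λ e → *-distribʳ-sum (ψ e) (λ y → ⟦ joins? x y e ⟧)) ⟩
    ∑[ e < size ] ∑[ y < order ] (⟦ joins? x y e ⟧ * ψ e)
      ≡⟨ ∑-comm (λ e y → ⟦ joins? x y e ⟧ * ψ e) ⟩
    ∑[ y < order ] ∑[ e < size ] (⟦ joins? x y e ⟧ * ψ e) ∎

  handshake : ∀ {m} (c : Coloring G m) s →
              ∑[ x < order ] colorCount G c x s ≡ 2 * ∑[ e < size ] ⟦ c e ≟ s ⟧
  handshake c s = begin
    ∑[ x < order ] colorCount G c x s
      ≡⟨ sum-cong-≗ (λ x → colorCount≡sum c x s) ⟩
    ∑[ x < order ] ∑[ e < size ] (⟦ incident? x e ⟧ * ⟦ c e ≟ s ⟧)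
      ≡⟨ ∑-comm (λ x e → ⟦ incident? x e ⟧ * ⟦ c e ≟ s ⟧) ⟩
    ∑[ e < size ] ∑[ x < order ] (⟦ incident? x e ⟧ * ⟦ c e ≟ s ⟧)
      ≡⟨ sum-cong-≗ (λ e → *-distribʳ-sum ⟦ c e ≟ s ⟧ (λ x → ⟦ incident? x e ⟧)) ⟨
    ∑[ e < size ] (∑[ x < order ] ⟦ incident? x e ⟧ * ⟦ c e ≟ s ⟧)
      ≡⟨ sum-cong-≗ (λ e → cong (_* ⟦ c e ≟ s ⟧) (sum-incident e)) ⟩
    ∑[ e < size ] (2 * ⟦ c e ≟ s ⟧)
      ≡⟨ *-distribˡ-sum 2 (λ e → ⟦ c e ≟ s ⟧) ⟨
    2 * ∑[ e < size ] ⟦ c e ≟ s ⟧ ∎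

-- Tables and rotations of colors

sum-++ : ∀ {a} {A : Set a} {p q} (f : Fin p → A) (g : Fin q → A) (φ : A → ℕ) →
         ∑[ i < p + q ] φ ((f ++ g) i) ≡ ∑[ i < p ] φ (f i) + ∑[ j < q ] φ (g j)
sum-++ {p = zero}  f g φ = refl
sum-++ {p = suc p} f g φ = trans
  (cong (φ (f zero) +_) (trans (sum-cong-≗ (λ i → cong φ ([,]-map (splitAt p i)))) (sum-++ (f ∘ suc) g φ)))
  (sym (+-assoc (φ (f zero)) _ _))

-- `nothing` marks the `r` vertices set aside; after them come `k` blocks of `p` vertices, each
-- block meeting every class once.
label : ∀ r k p → Fin (r + k * p) → Maybe (Fin p)
label zero    (suc k) p = just ++ label zero k p
label (suc r) k       p = λ { zero → nothing ; (suc v) → label r k p v }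

sum-label : ∀ r k p (φ : Maybe (Fin p) → ℕ) →
            ∑[ v < r + k * p ] φ (label r k p v) ≡ r * φ nothing + k * ∑[ a < p ] φ (just a)
sum-label zero    zero    p φ = refl
sum-label zero    (suc k) p φ = trans (sum-++ just (label zero k p) φ) (cong (_ +_) (sum-label zero k p φ))
sum-label (suc r) k       p φ = trans (cong (φ nothing +_) (sum-label r k p φ)) (sym (+-assoc (φ nothing) _ _))

-- Summing an arbitrary `φ` expresses that each color occurs `w` times in a row or on the diagonal:
-- indicator functions give back the multiplicities. In this form the fields apply directly to `φ` =
-- the number of hits of a given color.
record BalancedTable (m p w : ℕ) : Set where
  field
    entry        : Fin p → Fin p → Fin m
    entry-sym    : ∀ a b → entry a b ≡ entry b a
    row-sum      : ∀ a (φ : Fin m → ℕ) → ∑[ b < p ] φ (entry a b) ≡ w * sum φ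
    diagonal-sum : ∀ (φ : Fin m → ℕ) → ∑[ a < p ] φ (entry a a) ≡ w * sum φ

module Extension {m p w} (table : BalancedTable (suc m) p w) where
  open BalancedTable table

  extend : Maybe (Fin p) → Maybe (Fin p) → Fin (suc m)
  extend (just a) (just b) = entry a b
  extend (just a) nothing  = entry a a
  extend nothing  (just b) = entry b b
  extend nothing  nothing  = zero

  extend-sym : ∀ x y → extend x y ≡ extend y x
  extend-sym (just a) (just b) = entry-sym a b
  extend-sym (just a) nothing  = refl
  extend-sym nothing  (just b) = refl
  extend-sym nothing  nothing  = refl

  -- Each block contributes a row of the table if `x` has a class, and the diagonal if `x` was set
  -- aside; both are balanced. The `r` vertices set aside all contribute the color `extend x x`.
  sum-extend : ∀ r k x (φ : Fin (suc m) → ℕ) →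
               ∑[ v < r + k * p ] φ (extend x (label r k p v)) ≡ k * (w * sum φ) + r * φ (extend x x)
  sum-extend r k (just a) φ = trans (sum-label r k p (φ ∘ extend (just a)))
    (trans (cong (λ t → r * φ (entry a a) + k * t) (row-sum a φ)) (+-comm (r * φ (entry a a)) _))
  sum-extend r k nothing φ = trans (sum-label r k p (φ ∘ extend nothing))
    (trans (cong (λ t → r * φ zero + k * t) (diagonal-sum φ)) (+-comm (r * φ zero) _))

module Rotation {m} (rot : Fin m → Fin m) where

  spin : ℕ → Fin m → Fin m
  spin zero    z = z
  spin (suc a) z = spin a (rot z)

  hits : ℕ → Fin m → Fin m → ℕ
  hits l z s = ∑[ a < l ] ⟦ spin (toℕ a) z ≟ s ⟧

  -- The hypothesis says that `rot` is a permutation. Hence for each of the `l` shifts exactly one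
  -- starting color `z` is taken to `s`.
  sum-hits : (∀ (φ : Fin m → ℕ) → sum (φ ∘ rot) ≡ sum φ) →
             ∀ l s → ∑[ z < m ] hits l z s ≡ l
  sum-hits inv zero    s = trans (sum-const m 0) (*-zeroʳ m)
  sum-hits inv (suc l) s = begin
    ∑[ z < m ] (⟦ z ≟ s ⟧ + hits l (rot z) s)               ≡⟨ ∑-distrib-+ (λ z → ⟦ z ≟ s ⟧) (λ z → hits l (rot z) s) ⟩
    ∑[ z < m ] ⟦ z ≟ s ⟧ + ∑[ z < m ] hits l (rot z) s      ≡⟨ cong₂ _+_ (sum-≟ʳ s) (inv (λ z → hits l z s)) ⟩
    suc (∑[ z < m ] hits l z s)                             ≡⟨ cong suc (sum-hits inv l s) ⟩
    suc l                                                   ∎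

-- Off the diagonal, the colors split the complete graph on four classes into the paths 0-3-2-1 and
-- 2-0-1-3; the diagonal gives the ends of each path its color once more. Two classes would not do:
-- diagonal entries 0 and 1 ask for different entries off the diagonal.
table₂ : BalancedTable 2 4 2
table₂ = record { entry = entry ; entry-sym = entry-sym ; row-sum = row-sum ; diagonal-sum = diagonal-sum }
  where
  entry : Fin 4 → Fin 4 → Fin 2
  entry 0F 0F = 0F
  entry 0F 1F = 1F
  entry 0F 2F = 1F
  entry 0F 3F = 0F
  entry 1F 0F = 1F
  entry 1F 1F = 0F
  entry 1F 2F = 0F
  entry 1F 3F = 1F
  entry 2F 0F = 1F
  entry 2F 1F = 0F
  entry 2F 2F = 1F
  entry 2F 3F = 0F
  entry 3F 0F = 0F
  entry 3F 1F = 1F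
  entry 3F 2F = 0F
  entry 3F 3F = 1F

  entry-sym : ∀ a b → entry a b ≡ entry b a
  entry-sym = from-yes (all? λ a → all? λ b → entry a b ≟ entry b a)

  0110-sum : ∀ x y → x + (y + (y + (x + 0))) ≡ 2 * (x + (y + 0))
  0110-sum = solve-∀
  1001-sum : ∀ x y → y + (x + (x + (y + 0))) ≡ 2 * (x + (y + 0))
  1001-sum = solve-∀
  1010-sum : ∀ x y → y + (x + (y + (x + 0))) ≡ 2 * (x + (y + 0))
  1010-sum = solve-∀
  0101-sum : ∀ x y → x + (y + (x + (y + 0))) ≡ 2 * (x + (y + 0))
  0101-sum = solve-∀
  0011-sum : ∀ x y → x + (x + (y + (y + 0))) ≡ 2 * (x + (y + 0))
  0011-sum = solve-∀

  row-sum : ∀ a (φ : Fin 2 → ℕ) → ∑[ b < 4 ] φ (entry a b) ≡ 2 * sum φ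
  row-sum 0F φ = 0110-sum (φ 0F) (φ 1F)
  row-sum 1F φ = 1001-sum (φ 0F) (φ 1F)
  row-sum 2F φ = 1010-sum (φ 0F) (φ 1F)
  row-sum 3F φ = 0101-sum (φ 0F) (φ 1F)

  diagonal-sum : ∀ (φ : Fin 2 → ℕ) → ∑[ a < 4 ] φ (entry a a) ≡ 2 * sum φ
  diagonal-sum φ = 0011-sum (φ 0F) (φ 1F)

-- Addition modulo 3. The diagonal contains each color once because doubling is a bijection modulo
-- 3.
table₃ : BalancedTable 3 3 1
table₃ = record { entry = entry ; entry-sym = entry-sym ; row-sum = row-sum ; diagonal-sum = diagonal-sum }
  where
  entry : Fin 3 → Fin 3 → Fin 3
  entry 0F b  = b
  entry 1F 0F = 1F
  entry 1F 1F = 2F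
  entry 1F 2F = 0F
  entry 2F 0F = 2F
  entry 2F 1F = 0F
  entry 2F 2F = 1F

  entry-sym : ∀ a b → entry a b ≡ entry b a
  entry-sym = from-yes (all? λ a → all? λ b → entry a b ≟ entry b a)

  012-sum : ∀ x y z → x + (y + (z + 0)) ≡ 1 * (x + (y + (z + 0)))
  012-sum = solve-∀
  120-sum : ∀ x y z → y + (z + (x + 0)) ≡ 1 * (x + (y + (z + 0)))
  120-sum = solve-∀
  201-sum : ∀ x y z → z + (x + (y + 0)) ≡ 1 * (x + (y + (z + 0)))
  201-sum = solve-∀
  021-sum : ∀ x y z → x + (z + (y + 0)) ≡ 1 * (x + (y + (z + 0)))
  021-sum = solve-∀

  row-sum : ∀ a (φ : Fin 3 → ℕ) → ∑[ b < 3 ] φ (entry a b) ≡ 1 * sum φ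
  row-sum 0F φ = 012-sum (φ 0F) (φ 1F) (φ 2F)
  row-sum 1F φ = 120-sum (φ 0F) (φ 1F) (φ 2F)
  row-sum 2F φ = 201-sum (φ 0F) (φ 1F) (φ 2F)

  diagonal-sum : ∀ (φ : Fin 3 → ℕ) → ∑[ a < 3 ] φ (entry a a) ≡ 1 * sum φ
  diagonal-sum φ = 021-sum (φ 0F) (φ 1F) (φ 2F)

module Cyclic₂ where
  rot : Fin 2 → Fin 2
  rot 0F = 1F
  rot 1F = 0F

  open Rotation rot public

  sum-rot : ∀ (φ : Fin 2 → ℕ) → sum (φ ∘ rot) ≡ sum φ
  sum-rot φ = swap-sum (φ 0F) (φ 1F)
    where
    swap-sum : ∀ x y → y + (x + 0) ≡ x + (y + 0)
    swap-sum = solve-∀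

  -- The first two shifts meet each color once and lead back to `z`; for concrete `z` and `s` this
  -- is mere computation.
  hits-period : ∀ l z s → hits (2 + l) z s ≡ suc (hits l z s)
  hits-period l 0F 0F = refl
  hits-period l 0F 1F = refl
  hits-period l 1F 0F = refl
  hits-period l 1F 1F = refl

  hits-even : ∀ b z s → hits (b * 2) z s ≡ b
  hits-even zero    z s = refl
  hits-even (suc b) z s = trans (hits-period (b * 2) z s) (cong suc (hits-even b z s))

  hits-balanced : ∀ l z → Balanced (hits l z)
  hits-balanced 0 z s t = z≤n
  hits-balanced 1 = from-yes (all? λ z → all? λ s → all? λ t → hits 1 z s ≤? suc (hits 1 z t))
  hits-balanced (suc (suc l)) z s t
    rewrite hits-period l z s | hits-period l z t = s≤s (hits-balanced l z s t)

module Cyclic₃ where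
  rot : Fin 3 → Fin 3
  rot 0F = 1F
  rot 1F = 2F
  rot 2F = 0F

  open Rotation rot public

  sum-rot : ∀ (φ : Fin 3 → ℕ) → sum (φ ∘ rot) ≡ sum φ
  sum-rot φ = rotate-sum (φ 0F) (φ 1F) (φ 2F)
    where
    rotate-sum : ∀ x y z → y + (z + (x + 0)) ≡ x + (y + (z + 0))
    rotate-sum = solve-∀

  hits-period : ∀ l z s → hits (3 + l) z s ≡ suc (hits l z s)
  hits-period l 0F 0F = refl
  hits-period l 0F 1F = refl
  hits-period l 0F 2F = refl
  hits-period l 1F 0F = refl
  hits-period l 1F 1F = refl
  hits-period l 1F 2F = refl
  hits-period l 2F 0F = refl
  hits-period l 2F 1F = refl
  hits-period l 2F 2F = refl

  hits-balanced : ∀ l z → Balanced (hits l z)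
  hits-balanced 0 z s t = z≤n
  hits-balanced 1 = from-yes (all? λ z → all? λ s → all? λ t → hits 1 z s ≤? suc (hits 1 z t))
  hits-balanced 2 = from-yes (all? λ z → all? λ s → all? λ t → hits 2 z s ≤? suc (hits 2 z t))
  hits-balanced (suc (suc (suc l))) z s t
    rewrite hits-period l z s | hits-period l z t = s≤s (hits-balanced l z s t)

-- Colorings of complete multigraphs

module Complete {l n} {G : Multigraph} (complete : IsCompleteMultigraph l n G) where
  open Multigraph G
  open IsCompleteMultigraph complete

  sum-joins-edges : ∀ {x y} → x ≢ y → ∑[ e < size ] ⟦ joins? x y e ⟧ ≡ l
  sum-joins-edges {x} {y} x≢y = trans (sym (length-filter-tabulate (joins? x y) id)) (joined x y x≢y)

  sum-incident-weighted : ∀ x (ψ : Edge → ℕ) (g : Vertex → ℕ) →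
    (∀ y → x ≢ y → ∑[ e < size ] (⟦ joins? x y e ⟧ * ψ e) ≡ g y) →
    ∑[ e < size ] (⟦ incident? x e ⟧ * ψ e) + g x ≡ sum g
  sum-incident-weighted x ψ g f≗g = trans (cong (_+ g x) (sum-incident-by-neighbor G x ψ))
    (sum-update _ g x
      (trans (sum-cong-≗ (λ e → cong (_* ψ e) (joins-irrefl G e x))) (sum-replicate-zero size))
      f≗g)

  -- The degree l (n - 1), freed from subtraction by the fictitious pair of `x` with itself.
  degree+multiplicity : ∀ x → length (edgesAt x) + l ≡ n * l
  degree+multiplicity x = begin
    length (edgesAt x) + l
      ≡⟨ cong (_+ l) (trans (degree≡sum G x) (sum-cong-≗ (λ e → sym (*-identityʳ ⟦ incident? x e ⟧)))) ⟩
    ∑[ e < size ] (⟦ incident? x e ⟧ * 1) + l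
      ≡⟨ sum-incident-weighted x (λ _ → 1) (λ _ → l)
           (λ y x≢y → trans (sum-cong-≗ (λ e → *-identityʳ ⟦ joins? x y e ⟧)) (sum-joins-edges x≢y)) ⟩
    ∑[ y < order ] l
      ≡⟨ sum-const order l ⟩
    order * l
      ≡⟨ cong (_* l) order≡n ⟩
    n * l ∎

  module Shifted {m} (h : Vertex → Vertex → Fin m) (h-sym : ∀ x y → h x y ≡ h y x) (rot : Fin m → Fin m) where
    open Rotation rot

    edgeRank : Edge → ℕ
    edgeRank e = rank (joins? (proj₁ (ends e)) (proj₂ (ends e))) e

    shifted : Coloring G m
    shifted e = spin (edgeRank e) (h (proj₁ (ends e)) (proj₂ (ends e)))

    -- Parallel edges may list their ends in opposite orders. Neither the rank nor `h` depends on
    -- that order, so all of them follow one sequence of shifts.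
    shifted-joins : ∀ x y e → Joins x y e → shifted e ≡ spin (rank (joins? x y) e) (h x y)
    shifted-joins x y e (inj₁ eq) =
      cong (λ (u , v) → spin (rank (joins? u v) e) (h u v)) eq
    shifted-joins x y e (inj₂ eq) = trans
      (cong (λ (u , v) → spin (rank (joins? u v) e) (h u v)) eq)
      (cong₂ spin
        (rank-cong (joins? y x) (joins? x y)
          (λ e → ⟦⊎⟧-comm (≡-dec _≟_ _≟_ (ends e) (y , x)) (≡-dec _≟_ _≟_ (ends e) (x , y))) e)
        (h-sym y x))

    -- The `l` edges between `x` and `y` have the ranks 0 to l - 1, so their colors are the first
    -- `l` shifts of `h x y`.
    sum-joins-shifted : ∀ s x y → x ≢ y →
      ∑[ e < size ] (⟦ joins? x y e ⟧ * ⟦ shifted e ≟ s ⟧) ≡ hits l (h x y) s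
    sum-joins-shifted s x y x≢y = begin
      ∑[ e < size ] (⟦ joins? x y e ⟧ * ⟦ shifted e ≟ s ⟧)
        ≡⟨ sum-cong-≗ pointwise ⟩
      ∑[ e < size ] (⟦ joins? x y e ⟧ * φ (rank (joins? x y) e))
        ≡⟨ sum-rank (joins? x y) φ ⟩
      ∑[ a < (∑[ e < size ] ⟦ joins? x y e ⟧) ] φ (toℕ a)
        ≡⟨ cong (λ t → ∑[ a < t ] φ (toℕ a)) (sum-joins-edges x≢y) ⟩
      hits l (h x y) s ∎
      where
      φ : ℕ → ℕ
      φ a = ⟦ spin a (h x y) ≟ s ⟧
      pointwise : ∀ e → ⟦ joins? x y e ⟧ * ⟦ shifted e ≟ s ⟧ ≡ ⟦ joins? x y e ⟧ * φ (rank (joins? x y) e)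
      pointwise e = case joins? x y e of λ where
        (yes xy) → cong (λ c → ⟦ joins? x y e ⟧ * ⟦ c ≟ s ⟧) (shifted-joins x y e xy)
        (no ¬xy) → trans (cong (_* ⟦ shifted e ≟ s ⟧) (⟦⟧-no (joins? x y e) ¬xy))
                     (cong (_* φ (rank (joins? x y) e)) (sym (⟦⟧-no (joins? x y e) ¬xy)))

    colorCount-shifted : ∀ x s →
      colorCount G shifted x s + hits l (h x x) s ≡ ∑[ y < order ] hits l (h x y) s
    colorCount-shifted x s = trans (cong (_+ hits l (h x x) s) (colorCount≡sum G shifted x s))
      (sum-incident-weighted x (λ e → ⟦ shifted e ≟ s ⟧) (λ y → hits l (h x y) s) (sum-joins-shifted s x))

  module Tabulated {m p w} (table : BalancedTable (suc m) p w)
                   (rot : Fin (suc m) → Fin (suc m)) (sum-rot : ∀ (φ : Fin (suc m) → ℕ) → sum (φ ∘ rot) ≡ sum φ)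
                   (r k : ℕ) (n≡ : n ≡ r + k * p) where
    open Extension table
    open Rotation rot

    class : Vertex → Maybe (Fin p)
    class = subst (λ N → Fin N → Maybe (Fin p)) (sym (trans order≡n n≡)) (label r k p)

    sum-class : ∀ (φ : Maybe (Fin p) → ℕ) → ∑[ v < order ] φ (class v) ≡ ∑[ v < r + k * p ] φ (label r k p v)
    sum-class φ = transport (trans order≡n n≡)
      where
      -- The order of `G` is replaced by a variable `N`, so that the equation can be matched with
      -- `refl`.
      transport : ∀ {N} (eq : N ≡ r + k * p) →
                  ∑[ v < N ] φ (subst (λ N → Fin N → Maybe (Fin p)) (sym eq) (label r k p) v) ≡ ∑[ v < r + k * p ] φ (label r k p v)
      transport refl = refl

    pairColor : Vertex → Vertex → Fin (suc m)
    pairColor x y = extend (class x) (class y)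

    open Shifted pairColor (λ x y → extend-sym (class x) (class y)) rot public

    -- The equation N s + M s = k w l + r M s, where d is `pairColor x x` and M s is
    -- `hits l (pairColor x x) s`.
    colorCount-tabulated : ∀ x s →
      colorCount G shifted x s + hits l (pairColor x x) s ≡ k * (w * l) + r * hits l (pairColor x x) s
    colorCount-tabulated x s = begin
      colorCount G shifted x s + hits l (pairColor x x) s
        ≡⟨ colorCount-shifted x s ⟩
      ∑[ y < order ] hits l (pairColor x y) s
        ≡⟨ sum-class (λ y → hits l (extend (class x) y) s) ⟩
      ∑[ v < r + k * p ] hits l (extend (class x) (label r k p v)) s
        ≡⟨ sum-extend r k (class x) (λ z → hits l z s) ⟩
      k * (w * ∑[ z < suc m ] hits l z s) + r * hits l (pairColor x x) s
        ≡⟨ cong (λ t → k * (w * t) + r * hits l (pairColor x x) s) (sum-hits sum-rot l s) ⟩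
      k * (w * l) + r * hits l (pairColor x x) s ∎

    homogeneous-of-constant : (∀ z s t → hits l z s ≡ hits l z t) → IsHomogeneous G shifted
    homogeneous-of-constant const x = balanced⇒homogeneousAt G shifted x λ s t →
      m≤n⇒m≤1+n (≤-reflexive (+-cancelʳ-≡ (hits l (pairColor x x) s) _ _ (begin
        colorCount G shifted x s + hits l (pairColor x x) s ≡⟨ colorCount-tabulated x s ⟩
        k * (w * l) + r * hits l (pairColor x x) s          ≡⟨ cong (λ t → k * (w * l) + r * t) (const _ s t) ⟩
        k * (w * l) + r * hits l (pairColor x x) t          ≡⟨ colorCount-tabulated x t ⟨
        colorCount G shifted x t + hits l (pairColor x x) t ≡⟨ cong (colorCount G shifted x t +_) (const _ s t) ⟨
        colorCount G shifted x t + hits l (pairColor x x) s ∎)))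

    -- Here N = C + (r - 1) M with C constant. For r = 0, 1, 2 the factor is -1, 0, 1, so N spreads
    -- no more than M does.
    homogeneous-of-balanced : r ≤ 2 → (∀ z → Balanced (hits l z)) → IsHomogeneous G shifted
    homogeneous-of-balanced r≤2 bal x = balanced⇒homogeneousAt G shifted x
      (balanced-of-equation r r≤2 (bal (pairColor x x)) (colorCount-tabulated x))
      where
      balanced-of-equation : ∀ {f g : Fin (suc m) → ℕ} {C} r → r ≤ 2 → Balanced g →
                             (∀ s → f s + g s ≡ C + r * g s) → Balanced f
      -- As M enters negatively, its bound is used with the colors exchanged: N s + M s = N t + M t
      -- ≤ N t + 1 + M s.
      balanced-of-equation {f} {g} {C} 0 _ bal-g eq s t = +-cancelʳ-≤ (g s) _ _ (≤-trans
        (≤-reflexive (trans (eq s) (sym (eq t))))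
        (≤-trans (+-monoʳ-≤ (f t) (bal-g t s)) (≤-reflexive (+-suc (f t) (g s)))))
      balanced-of-equation {f} {g} {C} 1 _ bal-g eq s t =
        m≤n⇒m≤1+n (≤-reflexive (trans (f≡C s) (sym (f≡C t))))
        where
        f≡C : ∀ s → f s ≡ C
        f≡C s = +-cancelʳ-≡ (g s) _ _ (trans (eq s) (cong (C +_) (*-identityˡ (g s))))
      balanced-of-equation {f} {g} {C} 2 _ bal-g eq s t = ≤-trans (≤-reflexive (f≡ s))
        (≤-trans (+-monoʳ-≤ C (bal-g s t)) (≤-reflexive (trans (+-suc C (g t)) (cong suc (sym (f≡ t))))))
        where
        C+2x : ∀ C x → C + 2 * x ≡ (C + x) + x
        C+2x = solve-∀
        f≡ : ∀ s → f s ≡ C + g s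
        f≡ s = +-cancelʳ-≡ (g s) _ _ (trans (eq s) (C+2x C (g s)))
      balanced-of-equation (suc (suc (suc r))) (s≤s (s≤s ()))

  -- Existence with three and two colors, and the parity obstruction

  homogeneous₃ : HasHomogeneousColoring G 3
  homogeneous₃ = _ , Tabulated.homogeneous-of-balanced table₃ rot sum-rot (n % 3) (n / 3) (m≡m%n+[m/n]*n n 3)
                       -- A remainder modulo 3 is at most 2, so the balanced case covers every `n`.
                       (≤-pred (m%n<n n 3)) (hits-balanced l)
    where open Cyclic₃

  -- Only remainder 3 modulo 4 escapes the bound r ≤ 2. Then `l` is even, the shifts run through
  -- full periods, and M is constant.
  homogeneous₂ : ¬ (l % 2 ≡ 1 × n % 4 ≡ 3) → HasHomogeneousColoring G 2
  homogeneous₂ ¬odd3 with n % 4 ≤? 2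
  ... | yes n%4≤2 = _ , Tabulated.homogeneous-of-balanced table₂ rot sum-rot (n % 4) (n / 4) (m≡m%n+[m/n]*n n 4)
                          n%4≤2 (hits-balanced l)
    where open Cyclic₂
  ... | no n%4≰2 = _ , Tabulated.homogeneous-of-constant table₂ rot sum-rot (n % 4) (n / 4) (m≡m%n+[m/n]*n n 4)
                         (λ z s t → trans (hits≡ z s) (sym (hits≡ z t)))
    where
    open Cyclic₂
    n%4≡3 : n % 4 ≡ 3
    n%4≡3 = ≤-antisym (≤-pred (m%n<n n 4)) (≰⇒> n%4≰2)
    l%2≡0 : l % 2 ≡ 0
    l%2≡0 = n<1⇒n≡0 (≤∧≢⇒< (≤-pred (m%n<n l 2)) (λ l%2≡1 → ¬odd3 (l%2≡1 , n%4≡3)))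
    hits≡ : ∀ z s → hits l z s ≡ l / 2
    hits≡ z s = trans (cong (λ t → hits t z s) (trans (m≡m%n+[m/n]*n l 2) (cong (_+ l / 2 * 2) l%2≡0)))
                  (hits-even (l / 2) z s)

  ¬homogeneous₂ : l % 2 ≡ 1 → n % 4 ≡ 3 → ¬ HasHomogeneousColoring G 2
  ¬homogeneous₂ l%2≡1 n%4≡3 (c , hom) = even≢odd (∑[ e < size ] ⟦ c e ≟ 0F ⟧) Z (begin
    2 * ∑[ e < size ] ⟦ c e ≟ 0F ⟧         ≡⟨ handshake G c 0F ⟨
    ∑[ x < order ] colorCount G c x 0F     ≡⟨ sum-cong-≗ (λ x → count≡ x (hom x)) ⟩
    ∑[ x < order ] Q                       ≡⟨ sum-const order Q ⟩
    order * Q                              ≡⟨ cong (_* Q) (trans order≡n n≡) ⟩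
    (3 + n / 4 * 4) * Q                    ≡⟨ odd*odd (l / 2) (n / 4) ⟩
    suc (2 * Z)                            ∎)
    where
    -- With n = 4j + 3 and l = 2b + 1, half of (n - 1) l is (2j + 1)(2b + 1) = 1 + 2 (j + b + 2jb).
    -- `Z` is chosen so that n Q = 2 Z + 1.
    Y = n / 4 + l / 2 + 2 * (n / 4 * (l / 2))
    Z = 1 + 2 * (n / 4) + (3 + n / 4 * 4) * Y
    -- the common degree of the two color classes: half of (n − 1) l
    Q = suc (2 * Y)
    l≡ : l ≡ 1 + l / 2 * 2
    l≡ = trans (m≡m%n+[m/n]*n l 2) (cong (_+ l / 2 * 2) l%2≡1)
    n≡ : n ≡ 3 + n / 4 * 4
    n≡ = trans (m≡m%n+[m/n]*n n 4) (cong (_+ n / 4 * 4) n%4≡3)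
    odd*odd : ∀ b j → (3 + j * 4) * suc (2 * (j + b + 2 * (j * b))) ≡
                      suc (2 * (1 + 2 * j + (3 + j * 4) * (j + b + 2 * (j * b))))
    odd*odd = solve-∀
    n*l : ∀ b j → (3 + j * 4) * (1 + b * 2) ≡ 2 * suc (2 * (j + b + 2 * (j * b))) + (1 + b * 2)
    n*l = solve-∀
    degree≡2Q : ∀ x → length (edgesAt x) ≡ 2 * Q
    degree≡2Q x = +-cancelʳ-≡ l _ _ (begin
      length (edgesAt x) + l              ≡⟨ degree+multiplicity x ⟩
      n * l                               ≡⟨ cong₂ _*_ n≡ l≡ ⟩
      (3 + n / 4 * 4) * (1 + l / 2 * 2)   ≡⟨ n*l (l / 2) (n / 4) ⟩
      2 * Q + (1 + l / 2 * 2)             ≡⟨ cong (2 * Q +_) l≡ ⟨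
      2 * Q + l                           ∎)
    count≡ : ∀ x → HomogeneousAt G c x → colorCount G c x 0F ≡ Q
    -- The degree 2 Q is even, so the remainder is 0 and no color is exceptional: 0F ∈ T would let
    -- the removal of 0F push the size of T below 0.
    count≡ x (q , 0 , deg , _ , T , ∣T∣≡0 , _ , low) = trans
      (low 0F λ 0∈T → n≮0 (subst (∣ T - 0F ∣ <_) ∣T∣≡0 (x∈p⇒∣p-x∣<∣p∣ 0∈T)))
      (*-cancelˡ-≡ q Q 2 (trans (sym (+-identityʳ (2 * q))) (trans (sym deg) (degree≡2Q x))))
    count≡ x (q , 1 , deg , _) =
      contradiction (trans (sym (degree≡2Q x)) (trans deg (+-comm (2 * q) 1))) (even≢odd Q q)
    count≡ x (q , suc (suc r) , _ , s≤s (s≤s ()) , _)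

theorem3p5 : ∀ (l n : ℕ) → 1 ≤ l → 1 ≤ n →
    ∀ (G : Multigraph) → IsCompleteMultigraph l n G →
    ((l % 2 ≡ 1 × n % 4 ≡ 3) → HomogeneousChromaticIndex G 3)
    × (¬ (l % 2 ≡ 1 × n % 4 ≡ 3) → HomogeneousChromaticIndex G 2)
theorem3p5 l n _ _ G complete =
  (λ (l%2≡1 , n%4≡3) → record
    { 2≤m      = s≤s (s≤s z≤n)
    ; coloring = homogeneous₃
    -- The goal 3 ≤ k is 2 < k by definition, so it suffices to exclude k = 2.
    ; minimal  = λ k 2≤k has → ≤∧≢⇒< 2≤k λ 2≡k →
        ¬homogeneous₂ l%2≡1 n%4≡3 (subst (HasHomogeneousColoring G) (sym 2≡k) has)
    }) ,
  (λ ¬odd3 → record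
    { 2≤m      = ≤-refl
    ; coloring = homogeneous₂ ¬odd3
    ; minimal  = λ k 2≤k _ → 2≤k
    })
  where open Complete complete
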